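{- Let $p$ be a prime power, let $G$ be a cyclic group of order $p-1$, and let $W$ be a balanced generalized weighing matrix $BGW(p+1,p,p-1)$ over $G$. Then for every positive integer $m$ there exists a balanced generalized weighing matrix $$BGW\left(\frac{p^{m+1}-1}{p-1},\; p^m,\; p^{m-1}(p-1)\right)$$ over $G$.
   Context: Let $G$ be a finite multiplicatively written group. A balanced generalized weighing matrix over $G$ with parameters $(v,k,\lambda)$, denoted $BGW(v,k,\lambda)$ over $G$ or $BGW(v,k,\lambda;G)$, is a $v\times v$ matrix $W=[w_{ij}]$ with entries in $G\cup\{0\}$ (where $0\notin G$ is a formal zero symbol) such that each row of $W$ contains exactly $k$ nonzero entries and, for any distinct $i,j\in\{1,\dots,v\}$, the multiset $\{w_{i\ell}w_{j\ell}^{ -1} \mid 1\le \ell\le v,\ w_{i\ell}\ne 0\ne w_{j\ell}\}$ contains exactly $\lambda/|G|$ copies of every element of $G$. -}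

module Defs where

open import Algebra.Bundles using (Group)
import Algebra.Definitions.RawMonoid as RawMonoidDefs
open import Data.Fin.Base using (Fin)
open import Data.Fin.Properties using (nonZeroIndex) renaming (_≟_ to _≟ᶠ_)
open import Data.Integer.Base using (ℤ; +_; -[1+_])
open import Data.List.Base using (List; allFin; catMaybes; filter; length; map)
open import Data.Maybe.Base using (Maybe; zipWith)
open import Data.Nat.Base using (ℕ; suc; NonZero; _*_; _^_)
open import Data.Nat.Primality using (Prime)
open import Data.Product.Base using (∃; ∃₂; _×_)
open import Function.Bundles using (Inverse)
open import Function.Properties.Inverse using (Inverse⇒Injection)
open import Level using (Level; _⊔_)
open import Relation.Binary.Definitions using (Decidable)
open import Relation.Binary.PropositionalEquality.Core using (_≡_; _≢_)
open import Relation.Binary.PropositionalEquality.Properties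
  using () renaming (setoid to ≡-setoid)
open import Relation.Nullary.Decidable using (via-injection)

IsPrimePower : ℕ → Set
IsPrimePower p = ∃₂ λ q e → Prime q × NonZero e × p ≡ q ^ e

-- A finite group of order n: its elements, up to the group's own equality,
-- are enumerated by Fin n.
HasOrder : ∀ {c ℓ} → Group c ℓ → ℕ → Set (c ⊔ ℓ)
HasOrder G n = Inverse (Group.setoid G) (≡-setoid (Fin n))

order-nonZero : ∀ {c ℓ} (G : Group c ℓ) {n : ℕ} → HasOrder G n → NonZero n
order-nonZero G fin = nonZeroIndex (Inverse.to fin (Group.ε G))

module _ {c ℓ : Level} (G : Group c ℓ) where

  open Group G using (Carrier; _≈_; _∙_; _⁻¹; rawMonoid)
  open RawMonoidDefs rawMonoid using () renaming (_×_ to _times_)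

  -- The library's n × g is the n-fold product g ∙ (… ∙ ε).
  pow : Carrier → ℤ → Carrier
  pow g (+ n)    = n times g
  pow g -[1+ n ] = (suc n times g) ⁻¹

  IsCyclic : Set (c ⊔ ℓ)
  IsCyclic = ∃ λ g → ∀ x → ∃ λ k → x ≈ pow g k

  -- The formal zero symbol is nothing.
  Matrix : ℕ → Set c
  Matrix v = Fin v → Fin v → Maybe Carrier

  nonzeros : ∀ {v} → Matrix v → Fin v → List Carrier
  nonzeros {v} w i = catMaybes (map (w i) (allFin v))

  -- zipWith drops the columns in which either entry is zero.
  quotients : ∀ {v} → Matrix v → Fin v → Fin v → List Carrier
  quotients {v} w i j =
    catMaybes (map (λ l → zipWith (λ a b → a ∙ b ⁻¹) (w i l) (w j l)) (allFin v))

  module _ {n : ℕ} (fin : HasOrder G n) where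

    ≈-dec : Decidable _≈_
    ≈-dec = via-injection (Inverse⇒Injection fin) _≟ᶠ_

    multiplicity : Carrier → List Carrier → ℕ
    multiplicity g xs = length (filter (≈-dec g) xs)

    -- "λ/|G| copies" is stated as copies * |G| ≡ λ, so that the quotient is
    -- exact rather than rounded down.
    record BGW (v k lam : ℕ) : Set (c ⊔ ℓ) where
      field
        w        : Matrix v
        weight   : ∀ i → length (nonzeros w i) ≡ k
        balanced : ∀ i j → i ≢ j → ∀ g →
                   multiplicity g (quotients w i j) * n ≡ lam

{-# OPTIONS --safe #-}
module Submission where

-- Call the scalings g • A i of the rows of an array A, together with the zero
-- word, its code.  For a BGW matrix of this family any two distinct codewords
-- agree in a constant number of columns, and conversely double counting
-- recovers weight and balance from that constant.  Two distinct codewords of W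
-- agree exactly once, so its columns behave like the parallel classes of an
-- affine plane on F × F, F = G ∪ {0}, on which G acts diagonally; one class is
-- taken as the first coordinate y, the others are lines L_c(y , b).
--
-- From an array A of width v whose codewords agree a times, with
-- v = 1 + a p, form the codewords (y , L_c(y , x i)) with x in the code of A and
-- y ∈ F, one column for each pair (i , c) and one more for y.  If y ≠ z then
-- (x , y) and (x′ , z) agree once for every i, hence v times; if y = z they agree
-- in the column y and in p columns for each i with x i = x′ i, hence
-- 1 + a p = v times again.  Iteration starts at the 1 × 1 matrix with a = 0.

open import Defs
open import Algebra.Bundles using (Group; RawGroup)
open import Algebra.Core using (Op₁; Op₂)
import Algebra.Morphism.GroupMonomorphism as GroupMonomorphism
open import Algebra.Morphism.Structures using (IsGroupMonomorphism)
import Algebra.Properties.Group as GroupProperties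
open import Algebra.Structures using (IsGroup)
open import Data.Bool.Base using (true; false; if_then_else_)
open import Data.Fin.Base using (Fin; zero; suc; punchIn; remQuot; combine; _↑ˡ_; _↑ʳ_)
import Data.Fin.Properties as Fin
open import Data.List.Base using (length; catMaybes; filter; allFin; map; tabulate)
open import Data.List.Properties using (map-tabulate)
open import Data.Maybe.Base as Maybe using (Maybe; just; nothing; maybe′; zipWith)
open import Data.Maybe.Properties using (just-injective; ≡-dec)
open import Data.Nat.Base using (ℕ; zero; suc; NonZero; _+_; _*_; _∸_; _^_; _/_)
open import Data.Nat.DivMod using (m*n/n≡m)
open import Data.Nat.Properties
  using (+-assoc; +-comm; +-identityʳ; +-cancelˡ-≡; +-cancelʳ-≡; +-*-semiring;
         *-comm; *-identityˡ; *-identityʳ; *-zeroʳ; *-cancelˡ-≡; *-cancelʳ-≡;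
         m+n≡0⇒m≡0; m+n≡0⇒n≡0; m+n∸n≡m; suc-injective)
open import Data.Nat.Tactic.RingSolver using (solve-∀)
open import Data.Product.Base using (∃; _×_; _,_; proj₁; proj₂)
open import Data.Product.Properties using (,-injectiveˡ; ,-injectiveʳ)
open import Function.Base using (_∘_; id)
open import Function.Bundles using (_⇔_; mk⇔; Inverse)
open import Relation.Binary.Definitions using (DecidableEquality)
open import Relation.Binary.PropositionalEquality
open import Relation.Nullary using (Dec; yes; no; ¬_; does; contradiction)
open import Relation.Nullary.Decidable using (does-⇔; dec-true; dec-false)
open import Relation.Unary using (Pred; Decidable)

open import Algebra.Properties.Semiring.Sum +-*-semiring
  using (sum; sum-syntax; sum-cong-≗; sum-remove; ∑-distrib-+; ∑-comm; *-distribˡ-sum; *-distribʳ-sum)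

open ≡-Reasoning

-- Indicators and finite sums.

𝟙 : ∀ {a} {A : Set a} → Dec A → ℕ
𝟙 d = if does d then 1 else 0

module _ {a} {A : Set a} (d : Dec A) where

  𝟙-true : A → 𝟙 d ≡ 1
  𝟙-true x = cong (if_then 1 else 0) (dec-true d x)

  𝟙-false : ¬ A → 𝟙 d ≡ 0
  𝟙-false ¬x = cong (if_then 1 else 0) (dec-false d ¬x)

𝟙-⇔ : ∀ {a b} {A : Set a} {B : Set b} → A ⇔ B → (d : Dec A) (e : Dec B) → 𝟙 d ≡ 𝟙 e
𝟙-⇔ A⇔B d e = cong (if_then 1 else 0) (does-⇔ A⇔B d e)

∑-const : ∀ n c → ∑[ i < n ] c ≡ n * c
∑-const zero    c = refl
∑-const (suc n) c = cong (c +_) (∑-const n c)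

∑-zero : ∀ {n} (f : Fin n → ℕ) → (∀ i → f i ≡ 0) → sum f ≡ 0
∑-zero {n} f f≡0 = trans (sum-cong-≗ f≡0) (trans (∑-const n 0) (*-zeroʳ n))

∑≡0⇒≡0 : ∀ {n} (f : Fin n → ℕ) → sum f ≡ 0 → ∀ i → f i ≡ 0
∑≡0⇒≡0 f ∑f≡0 zero    = m+n≡0⇒m≡0 (f zero) ∑f≡0
∑≡0⇒≡0 f ∑f≡0 (suc i) = ∑≡0⇒≡0 (f ∘ suc) (m+n≡0⇒n≡0 (f zero) ∑f≡0) i

∑-𝟙≟ : ∀ {n} (i : Fin n) → ∑[ j < n ] 𝟙 (i Fin.≟ j) ≡ 1
∑-𝟙≟ {suc n} i = begin
  ∑[ j < suc n ] 𝟙 (i Fin.≟ j)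
    ≡⟨ sum-remove {i = i} (λ j → 𝟙 (i Fin.≟ j)) ⟩
  𝟙 (i Fin.≟ i) + ∑[ j < n ] 𝟙 (i Fin.≟ punchIn i j)
    ≡⟨ cong₂ _+_ (𝟙-true (i Fin.≟ i) refl)
         (∑-zero _ λ j → 𝟙-false (i Fin.≟ punchIn i j) (Fin.punchInᵢ≢i i j ∘ sym)) ⟩
  1 ∎

∑-splitAt : ∀ m {n} (f : Fin (m + n) → ℕ) →
            sum f ≡ ∑[ i < m ] f (i ↑ˡ n) + ∑[ j < n ] f (m ↑ʳ j)
∑-splitAt zero    f = refl
∑-splitAt (suc m) f = trans (cong (f zero +_) (∑-splitAt m (f ∘ suc))) (sym (+-assoc (f zero) _ _))

∑-combine : ∀ m n (f : Fin (m * n) → ℕ) → sum f ≡ ∑[ i < m ] ∑[ j < n ] f (combine i j)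
∑-combine zero    n f = refl
∑-combine (suc m) n f = trans (∑-splitAt n f)
  (cong (∑[ j < n ] f (j ↑ˡ (m * n)) +_) (∑-combine m n (f ∘ (n ↑ʳ_))))

∑-remQuot : ∀ m n (f : Fin m × Fin n → ℕ) →
            ∑[ k < m * n ] f (remQuot {m} n k) ≡ ∑[ i < m ] ∑[ j < n ] f (i , j)
∑-remQuot m n f = trans (∑-combine m n _)
  (sum-cong-≗ λ i → sum-cong-≗ λ j → cong f (Fin.remQuot-combine i j))

remQuot-injective : ∀ {m} n {k l : Fin (m * n)} → remQuot {m} n k ≡ remQuot n l → k ≡ l
remQuot-injective {m} n {k} {l} eq = begin
  k              ≡⟨ Fin.combine-remQuot {m} n k ⟨
  _              ≡⟨ cong (λ (i , j) → combine i j) eq ⟩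
  _              ≡⟨ Fin.combine-remQuot {m} n l ⟩
  l              ∎

-- With `symbol`, this numbers F = G ∪ {0} by `Fin (suc n)`, so that elements of F can select rows
-- of an array.
index : ∀ {n} → Maybe (Fin n) → Fin (suc n)
index nothing  = zero
index (just i) = suc i

index-injective : ∀ {n} {x y : Maybe (Fin n)} → index x ≡ index y → x ≡ y
index-injective {x = nothing} {nothing} _  = refl
index-injective {x = just _}  {just _}  eq = cong just (Fin.suc-injective eq)

symbol : ∀ {n} → Fin (suc n) → Maybe (Fin n)
symbol zero    = nothing
symbol (suc i) = just i

symbol-injective : ∀ {n} {i j : Fin (suc n)} → symbol i ≡ symbol j → i ≡ j
symbol-injective {i = zero}  {zero}  _  = refl
symbol-injective {i = suc _} {suc _} eq = cong suc (just-injective eq)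

-- Words over G ∪ {0}, their scalings and their agreements.

module Codes {n : ℕ} (_·_ : Op₂ (Fin n)) (ε : Fin n) (_⁻¹ : Op₁ (Fin n))
             (isGroup : IsGroup _≡_ _·_ ε _⁻¹) where

  open IsGroup isGroup using (assoc; identityˡ; identityʳ)

  group : Group _ _
  group = record { isGroup = isGroup }

  open GroupProperties group using
    (x≈z//y; ⁻¹-anti-homo-∙; \\-leftDividesˡ; \\-leftDividesʳ; //-rightDividesˡ; identityˡ-unique)

  F : Set
  F = Maybe (Fin n)

  infix 4 _≟_
  _≟_ : DecidableEquality F
  _≟_ = ≡-dec Fin._≟_

  infixr 7 _•_
  _•_ : Fin n → F → F
  g • x = Maybe.map (g ·_) x

  ε-• : ∀ x → ε • x ≡ x
  ε-• nothing  = refl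
  ε-• (just x) = cong just (identityˡ x)

  ·-• : ∀ g h x → (g · h) • x ≡ g • h • x
  ·-• g h nothing  = refl
  ·-• g h (just x) = cong just (assoc g h x)

  ⁻¹-•ʳ : ∀ g x → g ⁻¹ • g • x ≡ x
  ⁻¹-•ʳ g nothing  = refl
  ⁻¹-•ʳ g (just x) = cong just (\\-leftDividesʳ g x)

  •-injective : ∀ g {x y} → g • x ≡ g • y → x ≡ y
  •-injective g {x} {y} eq = trans (sym (⁻¹-•ʳ g x)) (trans (cong (g ⁻¹ •_) eq) (⁻¹-•ʳ g y))

  Word : ℕ → Set
  Word v = Fin v → F

  Array : ℕ → ℕ → Set
  Array u v = Fin u → Word v

  0ʷ : ∀ {v} → Word v
  0ʷ _ = nothing

  infixr 7 _•ʷ_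
  _•ʷ_ : ∀ {v} → Fin n → Word v → Word v
  (g •ʷ x) l = g • x l

  agr : ∀ {v} → Word v → Word v → ℕ
  agr x y = sum λ l → 𝟙 (x l ≟ y l)

  agr-cong : ∀ {v} {x x′ y y′ : Word v} → x ≗ x′ → y ≗ y′ → agr x y ≡ agr x′ y′
  agr-cong x≗x′ y≗y′ = sum-cong-≗ λ l → cong₂ (λ a b → 𝟙 (a ≟ b)) (x≗x′ l) (y≗y′ l)

  agr-sym : ∀ {v} (x y : Word v) → agr x y ≡ agr y x
  agr-sym x y = sum-cong-≗ λ l → 𝟙-⇔ (mk⇔ sym sym) (x l ≟ y l) (y l ≟ x l)

  agr-•ʷ : ∀ {v} g (x y : Word v) → agr (g •ʷ x) (g •ʷ y) ≡ agr x y
  agr-•ʷ g x y = sum-cong-≗ λ l →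
    𝟙-⇔ (mk⇔ (•-injective g) (cong (g •_))) (g • x l ≟ g • y l) (x l ≟ y l)

  common-zeros : ∀ {v} → Word v → Word v → ℕ
  common-zeros x y = sum λ l → 𝟙 (nothing ≟ x l) * 𝟙 (nothing ≟ y l)

  -- For nonzero a and b exactly one g satisfies a = g b; the other columns
  -- are accounted for by inclusion–exclusion on their zeros.
  ∑-agr-entry : ∀ (a b : F) →
    ∑[ g < n ] 𝟙 (a ≟ g • b) + 𝟙 (nothing ≟ a) + 𝟙 (nothing ≟ b)
      ≡ 1 + suc n * (𝟙 (nothing ≟ a) * 𝟙 (nothing ≟ b))
  ∑-agr-entry nothing nothing = trans (cong (λ s → s + 1 + 1) (∑-const n 1)) (arith n)
    where
    arith : ∀ n → n * 1 + 1 + 1 ≡ 1 + suc n * 1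
    arith = solve-∀
  ∑-agr-entry nothing (just b) = trans
    (cong (λ s → s + 1 + 0) (∑-zero {n} _ λ _ → refl)) (cong suc (sym (*-zeroʳ n)))
  ∑-agr-entry (just a) nothing = trans
    (cong (λ s → s + 0 + 1) (∑-zero {n} _ λ _ → refl)) (cong suc (sym (*-zeroʳ n)))
  ∑-agr-entry (just a) (just b) = begin
    ∑[ g < n ] 𝟙 (just a ≟ just (g · b)) + 0 + 0
      ≡⟨ trans (+-identityʳ _) (+-identityʳ _) ⟩
    ∑[ g < n ] 𝟙 (just a ≟ just (g · b))
      ≡⟨ sum-cong-≗ (λ g → 𝟙-⇔ (mk⇔
           (λ eq → sym (x≈z//y g b a (sym (just-injective eq))))
           (λ eq → cong just (trans (sym (//-rightDividesˡ b a)) (cong (_· b) eq))))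
           (just a ≟ just (g · b)) (a · (b ⁻¹) Fin.≟ g)) ⟩
    ∑[ g < n ] 𝟙 (a · (b ⁻¹) Fin.≟ g)
      ≡⟨ ∑-𝟙≟ (a · (b ⁻¹)) ⟩
    1
      ≡⟨ cong suc (*-zeroʳ n) ⟨
    1 + suc n * 0 ∎

  -- Double counting of the pairs (g , l): exchange the two sums and apply `∑-agr-entry` in each
  -- column. This ties the agreements of two rows to their common zeros, and is used both to read a
  -- matrix as a code and to read a code as a matrix.
  ∑-agr : ∀ {v} (x y : Word v) →
    ∑[ g < n ] agr x (g •ʷ y) + agr 0ʷ x + agr 0ʷ y ≡ v + suc n * common-zeros x y
  ∑-agr {v} x y = begin
    ∑[ g < n ] agr x (g •ʷ y) + agr 0ʷ x + agr 0ʷ y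
      ≡⟨ cong (λ s → s + agr 0ʷ x + agr 0ʷ y) (∑-comm {n} {v} λ g l → 𝟙 (x l ≟ g • y l)) ⟩
    sum s + agr 0ʷ x + agr 0ʷ y
      ≡⟨ cong (_+ agr 0ʷ y) (∑-distrib-+ s zx) ⟨
    sum (λ l → s l + zx l) + agr 0ʷ y
      ≡⟨ ∑-distrib-+ (λ l → s l + zx l) zy ⟨
    sum (λ l → s l + zx l + zy l)
      ≡⟨ sum-cong-≗ (λ l → ∑-agr-entry (x l) (y l)) ⟩
    sum (λ l → 1 + suc n * (zx l * zy l))
      ≡⟨ ∑-distrib-+ (λ _ → 1) (λ l → suc n * (zx l * zy l)) ⟩
    ∑[ l < v ] 1 + sum (λ l → suc n * (zx l * zy l))
      ≡⟨ cong₂ _+_ (trans (∑-const v 1) (*-identityʳ v))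
           (sym (*-distribˡ-sum (suc n) (λ l → zx l * zy l))) ⟩
    v + suc n * common-zeros x y ∎
    where
    s zx zy : Fin v → ℕ
    s l  = ∑[ g < n ] 𝟙 (x l ≟ g • y l)
    zx l = 𝟙 (nothing ≟ x l)
    zy l = 𝟙 (nothing ≟ y l)

  Index : ℕ → Set
  Index u = Maybe (Fin n × Fin u)

  word : ∀ {u v} → Array u v → Index u → Word v
  word A nothing        = 0ʷ
  word A (just (g , i)) = g •ʷ A i

  -- Distinctness is asked of indices and not of words, so that two names of one word are covered as
  -- well.
  Equidistant : ∀ {u v} → Array u v → ℕ → Set
  Equidistant A a = ∀ x y → x ≢ y → agr (word A x) (word A y) ≡ a

  module _ {u v} {A : Array u v} {a : ℕ} where

    -- Scaling both words by g⁻¹ keeps their agreements, so one of them may be taken to be a row. G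
    -- acts freely on nonzero symbols, hence two different multiples of one row agree exactly at its
    -- zeros.
    equidistant : (∀ i → agr 0ʷ (A i) ≡ a) →
                  (∀ i j → i ≢ j → ∀ g → agr (A i) (g •ʷ A j) ≡ a) → Equidistant A a
    equidistant zeros distinct = go
      where
      scaled-zeros : ∀ g i → agr 0ʷ (g •ʷ A i) ≡ a
      scaled-zeros g i = trans (agr-•ʷ g 0ʷ (A i)) (zeros i)

      shift : ∀ g i h j → agr (g •ʷ A i) (h •ʷ A j) ≡ agr (A i) ((g ⁻¹) · h •ʷ A j)
      shift g i h j = trans (sym (agr-•ʷ (g ⁻¹) (g •ʷ A i) (h •ʷ A j)))
        (agr-cong (λ l → ⁻¹-•ʳ g (A i l)) (λ l → sym (·-• (g ⁻¹) h (A j l))))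

      fixed : ∀ g → g ≢ ε → ∀ x → 𝟙 (x ≟ g • x) ≡ 𝟙 (nothing ≟ x)
      fixed g g≢ε nothing  = refl
      fixed g g≢ε (just x) = 𝟙-false (just x ≟ just (g · x))
        λ eq → g≢ε (identityˡ-unique g x (sym (just-injective eq)))

      go : Equidistant A a
      go nothing        nothing        x≢y = contradiction refl x≢y
      go nothing        (just (h , j)) x≢y = scaled-zeros h j
      go (just (g , i)) nothing        x≢y = trans (agr-sym (g •ʷ A i) 0ʷ) (scaled-zeros g i)
      go (just (g , i)) (just (h , j)) x≢y with i Fin.≟ j
      ... | no i≢j   = trans (shift g i h j) (distinct i j i≢j _)
      ... | yes refl = trans (shift g i h i) (trans (sum-cong-≗ λ l → fixed _ g⁻¹h≢ε (A i l)) (zeros i))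
        where
        g⁻¹h≢ε : (g ⁻¹) · h ≢ ε
        g⁻¹h≢ε eq = x≢y (cong (λ k → just (k , i))
          (trans (sym (identityʳ g)) (trans (cong (g ·_) (sym eq)) (\\-leftDividesˡ g h))))

    equidistant-zeros : Equidistant A a → ∀ i → agr 0ʷ (A i) ≡ a
    equidistant-zeros E i = trans
      (agr-cong {x = 0ʷ} (λ _ → refl) (λ l → sym (ε-• (A i l)))) (E nothing (just (ε , i)) λ ())

    equidistant-distinct : Equidistant A a → ∀ i j → i ≢ j → ∀ g → agr (A i) (g •ʷ A j) ≡ a
    equidistant-distinct E i j i≢j g =
      trans (agr-cong {y = g •ʷ A j} (λ l → sym (ε-• (A i l))) (λ _ → refl))
            (E (just (ε , i)) (just (g , j)) λ { refl → i≢j refl })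

  -- The affine plane of W and its parallel classes.

  module Step (W : Array (suc (suc n)) (suc (suc n))) (W-equidistant : Equidistant W 1)
              (W-zeros : ∀ i j → i ≢ j → common-zeros (W i) (W j) ≡ 0) where

    p : ℕ
    p = suc n

    -- The single agreement of row `zero` with the zero word is a zero of that row. Its column `ℓ₀`
    -- will carry the coordinate y.
    ∃-zero : ∃ λ l → W zero l ≡ nothing
    ∃-zero with Fin.any? (λ l → nothing ≟ W zero l)
    ... | yes (l , eq) = l , sym eq
    ... | no ∄         = contradiction
      (trans (sym (equidistant-zeros {A = W} W-equidistant zero))
             (∑-zero _ λ l → 𝟙-false (nothing ≟ W zero l) λ eq → ∄ (l , eq)))
      λ ()

    ℓ₀ : Fin (suc (suc n))
    ℓ₀ = proj₁ ∃-zero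

    -- A zero here would be shared with row `zero`. A nonzero entry lets a scaling of the row take
    -- any prescribed nonzero value in column `ℓ₀`.
    nonzero : ∀ s → ∃ λ g → W (suc s) ℓ₀ ≡ just g
    nonzero s with W (suc s) ℓ₀ in eq
    ... | just g  = g , refl
    ... | nothing = contradiction
      (trans (sym (cong₂ (λ a b → 𝟙 (nothing ≟ a) * 𝟙 (nothing ≟ b)) (proj₂ ∃-zero) eq))
             (∑≡0⇒≡0 (λ l → 𝟙 (nothing ≟ W zero l) * 𝟙 (nothing ≟ W (suc s) l))
                     (W-zeros zero (suc s) λ ()) ℓ₀))
      λ ()

    pivot : Fin p → Fin n
    pivot s = proj₁ (nonzero s)

    -- The codeword with entry y in column ℓ₀ and with second coordinate b.  For
    -- y ≠ 0 the row number depends only on y⁻¹ b, which makes point equivariant.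
    point : F → F → Index (suc (suc n))
    point nothing  nothing  = nothing
    point nothing  (just b) = just (b , zero)
    point (just y) b        = just (y · (pivot s ⁻¹) , suc s)
      where s = index (y ⁻¹ • b)

    word-point : ∀ y b → word W (point y b) ℓ₀ ≡ y
    word-point nothing  nothing  = refl
    word-point nothing  (just b) = cong (b •_) (proj₂ ∃-zero)
    word-point (just y) b        = trans (cong (y · (pivot s ⁻¹) •_) (proj₂ (nonzero s)))
                                         (cong just (//-rightDividesˡ (pivot s) y))
      where s = index (y ⁻¹ • b)

    -- For y ≠ 0 the row number recovers y⁻¹ b, hence b; for y = 0 the scalar is b itself.
    point-injectiveʳ : ∀ y {b c} → point y b ≡ point y c → b ≡ c
    point-injectiveʳ nothing  {nothing} {nothing} _  = refl
    point-injectiveʳ nothing  {just _}  {just _}  eq = cong (Maybe.map proj₁) eq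
    point-injectiveʳ (just y) eq = •-injective (y ⁻¹)
      (index-injective (Fin.suc-injective (cong proj₂ (just-injective eq))))

    -- Position c holds the label of the line of class c through the point (y , b).
    line : F → F → Word p
    line y b = word W (point y b) ∘ punchIn ℓ₀

    -- The diagonal action fixes y⁻¹ b, so the same row of W is used and only its scalar is
    -- multiplied by g.
    line-• : ∀ g y b c → line (g • y) (g • b) c ≡ g • line y b c
    line-• g nothing  nothing  c = refl
    line-• g nothing  (just b) c = ·-• g b (W zero (punchIn ℓ₀ c))
    line-• g (just y) b        c = begin
      (g · y) · (pivot s′ ⁻¹) • W (suc s′) (punchIn ℓ₀ c)
        ≡⟨ cong (λ s → (g · y) · (pivot s ⁻¹) • W (suc s) (punchIn ℓ₀ c)) s′≡s ⟩
      (g · y) · (pivot s ⁻¹) • W (suc s) (punchIn ℓ₀ c)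
        ≡⟨ cong (_• W (suc s) (punchIn ℓ₀ c)) (assoc g y (pivot s ⁻¹)) ⟩
      g · (y · (pivot s ⁻¹)) • W (suc s) (punchIn ℓ₀ c)
        ≡⟨ ·-• g (y · (pivot s ⁻¹)) (W (suc s) (punchIn ℓ₀ c)) ⟩
      g • y · (pivot s ⁻¹) • W (suc s) (punchIn ℓ₀ c) ∎
      where
      s′ s : Fin p
      s′ = index ((g · y) ⁻¹ • g • b)
      s  = index (y ⁻¹ • b)

      s′≡s : s′ ≡ s
      s′≡s = cong index (begin
        (g · y) ⁻¹ • g • b        ≡⟨ cong (_• (g • b)) (⁻¹-anti-homo-∙ g y) ⟩
        (y ⁻¹) · (g ⁻¹) • g • b   ≡⟨ ·-• (y ⁻¹) (g ⁻¹) (g • b) ⟩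
        y ⁻¹ • g ⁻¹ • g • b       ≡⟨ cong (y ⁻¹ •_) (⁻¹-•ʳ g b) ⟩
        y ⁻¹ • b                  ∎)

    agr-point : ∀ y b z c →
      agr (word W (point y b)) (word W (point z c)) ≡ 𝟙 (y ≟ z) + agr (line y b) (line z c)
    agr-point y₀ b z₀ c = trans
      (sum-remove {i = ℓ₀} λ l → 𝟙 (word W (point y₀ b) l ≟ word W (point z₀ c) l))
      (cong₂ (λ y z → 𝟙 (y ≟ z) + agr (line y₀ b) (line z₀ c)) (word-point y₀ b) (word-point z₀ c))

    -- The two codewords differ in column `ℓ₀`, so their only agreement lies in the remaining
    -- columns.
    agr-line-≢ : ∀ {y z} b c → y ≢ z → agr (line y b) (line z c) ≡ 1
    agr-line-≢ {y} {z} b c y≢z = begin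
      agr (line y b) (line z c)
        ≡⟨ cong (_+ agr (line y b) (line z c)) (𝟙-false (y ≟ z) y≢z) ⟨
      𝟙 (y ≟ z) + agr (line y b) (line z c)
        ≡⟨ agr-point y b z c ⟨
      agr (word W (point y b)) (word W (point z c))
        ≡⟨ W-equidistant (point y b) (point z c) (λ eq → y≢z
             (trans (sym (word-point y b)) (trans (cong (λ x → word W x ℓ₀) eq) (word-point z c)))) ⟩
      1 ∎

    -- For b ≠ c the only agreement is used up by column `ℓ₀`.
    agr-line-≡ : ∀ y b c → agr (line y b) (line y c) ≡ 𝟙 (b ≟ c) * p
    agr-line-≡ y b c with b ≟ c
    ... | yes refl = begin
      agr (line y b) (line y b) ≡⟨ sum-cong-≗ (λ l → 𝟙-true (line y b l ≟ line y b l) refl) ⟩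
      ∑[ l < p ] 1              ≡⟨ ∑-const p 1 ⟩
      p * 1                     ≡⟨ *-comm p 1 ⟩
      1 * p                     ∎
    ... | no b≢c   = suc-injective (begin
      1 + agr (line y b) (line y c)
        ≡⟨ cong (_+ agr (line y b) (line y c)) (𝟙-true (y ≟ y) refl) ⟨
      𝟙 (y ≟ y) + agr (line y b) (line y c)
        ≡⟨ agr-point y b y c ⟨
      agr (word W (point y b)) (word W (point y c))
        ≡⟨ W-equidistant (point y b) (point y c) (b≢c ∘ point-injectiveʳ y) ⟩
      1 ∎)

    -- The recursive step on arrays, and its iteration.

    ext : ∀ {v} → Word v → F → Word (suc (v * p))
    ext x y zero        = y
    ext {v} x y (suc k) = let i , c = remQuot {v} p k in line y (x i) c

    ext-• : ∀ {v} g (x : Word v) y → g •ʷ ext x y ≗ ext (g •ʷ x) (g • y)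
    ext-• g x y zero        = refl
    ext-• {v} g x y (suc k) = let i , c = remQuot {v} p k in sym (line-• g y (x i) c)

    agr-ext : ∀ {v} (x x′ : Word v) y y′ →
      agr (ext x y) (ext x′ y′) ≡ 𝟙 (y ≟ y′) + ∑[ i < v ] agr (line y (x i)) (line y′ (x′ i))
    agr-ext {v} x x′ y y′ = cong (𝟙 (y ≟ y′) +_)
      (∑-remQuot v p λ (i , c) → 𝟙 (line y (x i) c ≟ line y′ (x′ i) c))

    agr-ext-≢ : ∀ {v} (x x′ : Word v) {y y′} → y ≢ y′ → agr (ext x y) (ext x′ y′) ≡ v
    agr-ext-≢ {v} x x′ {y} {y′} y≢y′ = begin
      agr (ext x y) (ext x′ y′)   ≡⟨ agr-ext x x′ y y′ ⟩
      _                           ≡⟨ cong₂ _+_ (𝟙-false (y ≟ y′) y≢y′)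
                                       (sum-cong-≗ λ i → agr-line-≢ (x i) (x′ i) y≢y′) ⟩
      ∑[ i < v ] 1                ≡⟨ ∑-const v 1 ⟩
      v * 1                       ≡⟨ *-identityʳ v ⟩
      v                           ∎

    agr-ext-≡ : ∀ {v} (x x′ : Word v) y → agr (ext x y) (ext x′ y) ≡ suc (agr x x′ * p)
    agr-ext-≡ {v} x x′ y = begin
      agr (ext x y) (ext x′ y)                  ≡⟨ agr-ext x x′ y y ⟩
      _                                         ≡⟨ cong₂ _+_ (𝟙-true (y ≟ y) refl)
                                                     (sum-cong-≗ λ i → agr-line-≡ y (x i) (x′ i)) ⟩
      suc (∑[ i < v ] (𝟙 (x i ≟ x′ i) * p))     ≡⟨ cong suc (*-distribʳ-sum p λ i → 𝟙 (x i ≟ x′ i)) ⟨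
      suc (agr x x′ * p)                        ∎

    -- The rows represent the orbits of G on the nonzero pairs (codeword of A , y): a row of A with
    -- any y in F, and the zero word with y = ε.
    next : ∀ {u v} → Array u v → Array (suc (u * p)) (suc (v * p))
    next {v = v} A zero = ext {v} 0ʷ (just ε)
    next {u} A (suc k) = let r , y = remQuot {u} p k in ext (A r) (symbol y)

    -- Recovers the pair (codeword of A , y) behind a codeword of `next A`; by `ext-•` a scalar acts
    -- on both coordinates at once.
    split : ∀ {u} → Index (suc (u * p)) → Index u × F
    split nothing              = nothing , nothing
    split (just (g , zero))    = nothing , just g
    split {u} (just (g , suc k)) = let r , y = remQuot {u} p k in just (g , r) , g • symbol y

    -- When a row of A is involved, the first coordinate determines the scalar, which can then be
    -- cancelled from the second.
    split-injective : ∀ {u} (x y : Index (suc (u * p))) → split {u} x ≡ split y → x ≡ y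
    split-injective nothing           nothing           _    = refl
    split-injective (just (g , zero)) (just (h , zero)) eq   =
      cong (Maybe.map (_, zero)) (cong proj₂ eq)
    split-injective nothing              (just (_ , zero))  ()
    split-injective nothing              (just (_ , suc _)) ()
    split-injective (just (_ , zero))    nothing            ()
    split-injective (just (_ , zero))    (just (_ , suc _)) ()
    split-injective (just (_ , suc _))   nothing            ()
    split-injective (just (_ , suc _))   (just (_ , zero))  ()
    split-injective {u} (just (g , suc k)) (just (h , suc l)) eq =
      cong₂ (λ g k → just (g , suc k)) (cong proj₁ parts) (remQuot-injective {u} p (cong proj₂ parts))
      where
      components : ∀ {g h} {r s : Fin u} {y z} →
        (just (g , r) , g • symbol y) ≡ (just (h , s) , h • symbol z) → (g , (r , y)) ≡ (h , (s , z))
      components {g} eq with refl ← ,-injectiveˡ eq =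
        cong (λ y → g , (_ , y)) (symbol-injective (•-injective g (,-injectiveʳ eq)))

      parts : (g , remQuot {u} p k) ≡ (h , remQuot p l)
      parts = components eq

    word-next : ∀ {u v} (A : Array u v) x →
      word (next A) x ≗ ext (word A (proj₁ (split {u} x))) (proj₂ (split {u} x))
    word-next A nothing           zero    = refl
    word-next A nothing           (suc k) = refl
    word-next {v = v} A (just (g , zero)) l = trans (ext-• {v} g 0ʷ (just ε) l)
      (cong (λ h → ext {v} 0ʷ (just h) l) (identityʳ g))
    word-next {u} A (just (g , suc k)) l  = let r , y = remQuot {u} p k in ext-• g (A r) (symbol y) l

    -- The width of A is 1 + a p, which is what makes the cases y ≠ z and y = z give the same count.
    -- If y = z, distinct pairs have distinct first coordinates, and the hypothesis on A applies.
    next-equidistant : ∀ {u a} {A : Array u (suc (a * p))} →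
      Equidistant A a → Equidistant (next A) (suc (a * p))
    next-equidistant {u} {a} {A} E x y x≢y = 
      trans (agr-cong {y = word (next A) y} (word-next A x) (word-next A y))
            (go (split {u} x) (split {u} y) (x≢y ∘ split-injective {u} x y))
      where
      go : ∀ (s t : Index u × F) → s ≢ t →
           agr (ext (word A (proj₁ s)) (proj₂ s)) (ext (word A (proj₁ t)) (proj₂ t)) ≡ suc (a * p)
      go (s , y) (t , z) s≢t = by-cases (y ≟ z)
        where
        by-cases : Dec (y ≡ z) → agr (ext (word A s) y) (ext (word A t) z) ≡ suc (a * p)
        by-cases (no y≢z)   = agr-ext-≢ (word A s) (word A t) y≢z
        by-cases (yes refl) = trans (agr-ext-≡ (word A s) (word A t) y)
                                    (cong (λ a → suc (a * p)) (E s t λ { refl → s≢t refl }))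

    -- The sum 1 + p + ... + p^(m-1), that is (p^m - 1)/(p - 1). The array at stage m has width
    -- `points (suc m)` and agreement number `points m`.
    points : ℕ → ℕ
    points zero    = 0
    points (suc m) = suc (points m * p)

    array : ∀ m → Array (points (suc m)) (points (suc m))
    array zero    = λ _ _ → just ε
    array (suc m) = next (array m)

    array-equidistant : ∀ m → Equidistant (array m) (points m)
    array-equidistant (suc m) = next-equidistant (array-equidistant m)
    array-equidistant zero    = equidistant (λ _ → refl) λ { zero zero 0≢0 → contradiction refl 0≢0 }

    points-^ : ∀ m → points m * n + 1 ≡ p ^ m
    points-^ zero    = refl
    points-^ (suc m) = trans (arith n (points m)) (cong (p *_) (points-^ m))
      where
      arith : ∀ n a → suc (a * suc n) * n + 1 ≡ suc n * (a * n + 1)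
      arith = solve-∀

-- List lengths as sums over columns.

module _ {a} {A : Set a} where

  length-filter-catMaybes : ∀ {ℓ} {P : Pred A ℓ} (P? : Decidable P) {v} (f : Fin v → Maybe A) →
    length (filter P? (catMaybes (map f (allFin v)))) ≡ ∑[ l < v ] maybe′ (𝟙 ∘ P?) 0 (f l)
  length-filter-catMaybes P? f =
    trans (cong (length ∘ filter P? ∘ catMaybes) (map-tabulate id f)) (go f)
    where
    go : ∀ {v} (f : Fin v → Maybe A) →
         length (filter P? (catMaybes (tabulate f))) ≡ ∑[ l < v ] maybe′ (𝟙 ∘ P?) 0 (f l)
    go {zero}  f = refl
    go {suc v} f with f zero
    ... | nothing = go (f ∘ suc)
    ... | just x with does (P? x)
    ...   | true  = cong suc (go (f ∘ suc))
    ...   | false = go (f ∘ suc)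

  length-catMaybes : ∀ {v} (f : Fin v → Maybe A) →
    length (catMaybes (map f (allFin v))) ≡ ∑[ l < v ] maybe′ (λ _ → 1) 0 (f l)
  length-catMaybes f = trans (cong (length ∘ catMaybes) (map-tabulate id f)) (go f)
    where
    go : ∀ {v} (f : Fin v → Maybe A) →
         length (catMaybes (tabulate f)) ≡ ∑[ l < v ] maybe′ (λ _ → 1) 0 (f l)
    go {zero}  f = refl
    go {suc v} f with f zero
    ... | nothing = go (f ∘ suc)
    ... | just x  = cong suc (go (f ∘ suc))

-- Passage between matrices over G and arrays over `Fin n`.

module Transport {c ℓ} (G : Group c ℓ) {n : ℕ} (fin : HasOrder G n) where

  open Group G using (Carrier; _≈_; _∙_; _⁻¹; ε; rawGroup)
  private module G = Group G
  open Inverse fin using (to; from; to-cong; strictlyInverseˡ; strictlyInverseʳ)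

  -- On `Fin n` the group equality becomes propositional and a sum over G becomes a finite sum. The
  -- group laws are pulled back along the injective homomorphism `from`.
  finRawGroup : RawGroup _ _
  finRawGroup = record
    { _≈_ = _≡_
    ; _∙_ = λ i j → to (from i ∙ from j)
    ; ε   = to ε
    ; _⁻¹ = λ i → to (from i ⁻¹)
    }

  from-injective : ∀ {i j} → from i ≈ from j → i ≡ j
  from-injective {i} {j} eq = trans (sym (strictlyInverseˡ i)) (trans (to-cong eq) (strictlyInverseˡ j))

  from-isGroupMonomorphism : IsGroupMonomorphism finRawGroup rawGroup from
  from-isGroupMonomorphism = record
    { isGroupHomomorphism = record
      { isMonoidHomomorphism = record
        { isMagmaHomomorphism = record
          { isRelHomomorphism = record { cong = λ { refl → G.refl } }
          ; homo = λ i j → strictlyInverseʳ _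
          }
        ; ε-homo = strictlyInverseʳ _
        }
      ; ⁻¹-homo = λ i → strictlyInverseʳ _
      }
    ; injective = from-injective
    }

  open RawGroup finRawGroup using () renaming (_∙_ to _·_; ε to e; _⁻¹ to inv)

  open Codes _·_ e inv (GroupMonomorphism.isGroup from-isGroupMonomorphism G.isGroup) public

  encode : ∀ {v} → Matrix G v → Array v v
  encode w i l = Maybe.map to (w i l)

  decode : ∀ {v} → Array v v → Matrix G v
  decode A i l = Maybe.map from (A i l)

  encode-decode : ∀ {v} (A : Array v v) i → encode (decode A) i ≗ A i
  encode-decode A i l with A i l
  ... | nothing = refl
  ... | just x  = cong just (strictlyInverseˡ x)

  nonzeros+zeros : ∀ {v} (w : Matrix G v) i → length (nonzeros G w i) + agr 0ʷ (encode w i) ≡ v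
  nonzeros+zeros {v} w i = begin
    length (nonzeros G w i) + agr 0ʷ (encode w i)
      ≡⟨ cong (_+ agr 0ʷ (encode w i)) (length-catMaybes (w i)) ⟩
    sum (λ l → maybe′ (λ _ → 1) 0 (w i l)) + agr 0ʷ (encode w i)
      ≡⟨ ∑-distrib-+ {v} (λ l → maybe′ (λ _ → 1) 0 (w i l)) _ ⟨
    sum (λ l → maybe′ (λ _ → 1) 0 (w i l) + 𝟙 (nothing ≟ encode w i l))
      ≡⟨ sum-cong-≗ (λ l → entry (w i l)) ⟩
    ∑[ l < v ] 1
      ≡⟨ ∑-const v 1 ⟩
    v * 1
      ≡⟨ *-identityʳ v ⟩
    v ∎
    where
    entry : ∀ x → maybe′ (λ _ → 1) 0 x + 𝟙 (nothing ≟ Maybe.map to x) ≡ 1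
    entry nothing  = refl
    entry (just _) = refl

  quotient-⇔ : ∀ g x y → (g ≈ x ∙ y ⁻¹) ⇔ (just (to x) ≡ to g • just (to y))
  quotient-⇔ g x y = mk⇔ ⇒ ⇐
    where
    open GroupProperties G using (//-rightDividesˡ; x≈z//y)

    to-homo : to (g ∙ y) ≡ to g · to y
    to-homo = to-cong (G.sym (G.∙-cong (strictlyInverseʳ g) (strictlyInverseʳ y)))

    ⇒ : g ≈ x ∙ y ⁻¹ → just (to x) ≡ to g • just (to y)
    ⇒ g≈x/y = cong just (trans
      (to-cong (G.trans (G.sym (//-rightDividesˡ y x)) (G.∙-congʳ (G.sym g≈x/y)))) to-homo)

    ⇐ : just (to x) ≡ to g • just (to y) → g ≈ x ∙ y ⁻¹
    ⇐ eq = x≈z//y g y x (G.trans (G.sym (strictlyInverseʳ _)) (G.trans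
      (G.reflexive (cong from (trans to-homo (sym (just-injective eq))))) (strictlyInverseʳ x)))

  -- Row i agrees with g times row j where both entries are nonzero with quotient g, or where both
  -- are zero.
  multiplicity+zeros : ∀ {v} (w : Matrix G v) i j g →
    multiplicity G fin g (quotients G w i j) + common-zeros (encode w i) (encode w j)
      ≡ agr (encode w i) (to g •ʷ encode w j)
  multiplicity+zeros {v} w i j g = begin
    multiplicity G fin g (quotients G w i j) + common-zeros (encode w i) (encode w j)
      ≡⟨ cong (_+ common-zeros (encode w i) (encode w j))
           (length-filter-catMaybes (≈-dec G fin g) (λ l → ratio (w i l) (w j l))) ⟩
    sum (λ l → hits (w i l) (w j l)) + common-zeros (encode w i) (encode w j)
      ≡⟨ ∑-distrib-+ {v} (λ l → hits (w i l) (w j l)) _ ⟨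
    _
      ≡⟨ sum-cong-≗ (λ l → entry (w i l) (w j l)) ⟩
    agr (encode w i) (to g •ʷ encode w j) ∎
    where
    ratio : Maybe Carrier → Maybe Carrier → Maybe Carrier
    ratio = zipWith (λ a b → a ∙ b ⁻¹)

    hits : Maybe Carrier → Maybe Carrier → ℕ
    hits x y = maybe′ (λ x → 𝟙 (≈-dec G fin g x)) 0 (ratio x y)

    entry : ∀ x y → hits x y + 𝟙 (nothing ≟ Maybe.map to x) * 𝟙 (nothing ≟ Maybe.map to y)
                  ≡ 𝟙 (Maybe.map to x ≟ to g • Maybe.map to y)
    entry nothing  nothing  = refl
    entry nothing  (just _) = refl
    entry (just _) nothing  = refl
    entry (just x) (just y) = trans (+-identityʳ _)
      (𝟙-⇔ (quotient-⇔ g x y) (≈-dec G fin g (x ∙ y ⁻¹)) (just (to x) ≟ to g • just (to y)))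

  -- The given matrix yields a code with agreement number 1.

  module FromBGW .{{_ : NonZero n}} (W : BGW G fin (suc (suc n)) (suc n) n) where

    open BGW W

    zeros : ∀ i → agr 0ʷ (encode w i) ≡ 1
    zeros i = +-cancelˡ-≡ (suc n) _ _ (begin
      suc n + agr 0ʷ (encode w i)                     ≡⟨ cong (_+ agr 0ʷ (encode w i)) (weight i) ⟨
      length (nonzeros G w i) + agr 0ʷ (encode w i)   ≡⟨ nonzeros+zeros w i ⟩
      suc (suc n)                                     ≡⟨ +-comm (suc n) 1 ⟨
      suc n + 1                                       ∎)

    agr-distinct : ∀ i j → i ≢ j → ∀ g →
      agr (encode w i) (g •ʷ encode w j) ≡ 1 + common-zeros (encode w i) (encode w j)
    agr-distinct i j i≢j g = begin
      agr (encode w i) (g •ʷ encode w j)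
        ≡⟨ cong (λ h → agr (encode w i) (h •ʷ encode w j)) (strictlyInverseˡ g) ⟨
      agr (encode w i) (to (from g) •ʷ encode w j)
        ≡⟨ multiplicity+zeros w i j (from g) ⟨
      multiplicity G fin (from g) (quotients G w i j) + common-zeros (encode w i) (encode w j)
        -- Here λ = n = |G|, so each group element occurs exactly once as a quotient.
        ≡⟨ cong (_+ common-zeros (encode w i) (encode w j))
             (*-cancelʳ-≡ (multiplicity G fin (from g) (quotients G w i j)) 1 n
               (trans (balanced i j i≢j (from g)) (sym (*-identityˡ n)))) ⟩
      1 + common-zeros (encode w i) (encode w j) ∎

    -- With z common zeros, `∑-agr` reads n (1 + z) + 2 = n + 2 + (n + 1) z, which forces z = 0.
    no-common-zeros : ∀ i j → i ≢ j → common-zeros (encode w i) (encode w j) ≡ 0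
    no-common-zeros i j i≢j = sym (+-cancelˡ-≡ (n + 2 + n * z) 0 z (begin
      n + 2 + n * z + 0                       ≡⟨ left n z ⟩
      n * (1 + z) + 1 + 1                     ≡⟨ cong (λ s → s + 1 + 1) (∑-const n (1 + z)) ⟨
      ∑[ g < n ] (1 + z) + 1 + 1              ≡⟨ cong (λ s → s + 1 + 1) (sum-cong-≗ (agr-distinct i j i≢j)) ⟨
      _                                       ≡⟨ cong₂ (λ a b → ∑[ g < n ] agr (encode w i) (g •ʷ encode w j) + a + b)
                                                   (zeros i) (zeros j) ⟨
      _                                       ≡⟨ ∑-agr (encode w i) (encode w j) ⟩
      suc (suc n) + suc n * z                 ≡⟨ right n z ⟩
      n + 2 + n * z + z                       ∎))
      where
      z : ℕ
      z = common-zeros (encode w i) (encode w j)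

      left : ∀ n z → n + 2 + n * z + 0 ≡ n * (1 + z) + 1 + 1
      left = solve-∀

      right : ∀ n z → suc (suc n) + suc n * z ≡ n + 2 + n * z + z
      right = solve-∀

    encode-equidistant : Equidistant (encode w) 1
    encode-equidistant = equidistant {A = encode w} zeros λ i j i≢j g →
      trans (agr-distinct i j i≢j g) (cong suc (no-common-zeros i j i≢j))

  -- An equidistant square array yields a balanced matrix.

  module ToBGW {a v k μ : ℕ} (A : Array v v) (E : Equidistant A a) (v≡1+a*p : v ≡ suc (a * suc n))
               (k≡ : a * n + 1 ≡ k) (k≡p*μ : k ≡ suc n * μ) where

    zeros : ∀ i → agr 0ʷ (encode (decode A) i) ≡ a
    zeros i = trans (agr-cong {x = 0ʷ} (λ _ → refl) (encode-decode A i)) (equidistant-zeros {A = A} E i)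

    agr-distinct : ∀ i j → i ≢ j → ∀ g →
      agr (encode (decode A) i) (g •ʷ encode (decode A) j) ≡ a
    agr-distinct i j i≢j g = trans
      (agr-cong (encode-decode A i) (λ l → cong (g •_) (encode-decode A j l)))
      (equidistant-distinct {A = A} E i j i≢j g)

    -- Write p = n + 1. Double counting gives a = 1 + p z for the number z of common zeros, and N +
    -- z = a. Hence p N = p a - p z = a n + 1 = k = p μ.
    multiplicity≡ : ∀ i j → i ≢ j → ∀ g → multiplicity G fin g (quotients G (decode A) i j) ≡ μ
    multiplicity≡ i j i≢j g = *-cancelˡ-≡ N μ (suc n)
      -- The summand to be cancelled lets both equations be added without subtraction in ℕ.
      (+-cancelˡ-≡ (a + a + (n * a + suc n * z)) _ _ (begin
        a + a + (n * a + suc n * z) + suc n * N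
          ≡⟨ collect n a z N ⟩
        n * a + a + a + suc n * (N + z)
          ≡⟨ cong₂ _+_ double-count (cong (suc n *_) N+z≡a) ⟩
        suc (a * suc n) + suc n * z + suc n * a
          ≡⟨ regroup n a z ⟩
        a + a + (n * a + suc n * z) + (a * n + 1)
          ≡⟨ cong (a + a + (n * a + suc n * z) +_) (trans k≡ k≡p*μ) ⟩
        a + a + (n * a + suc n * z) + suc n * μ ∎))
      where
      N z : ℕ
      N = multiplicity G fin g (quotients G (decode A) i j)
      z = common-zeros (encode (decode A) i) (encode (decode A) j)

      N+z≡a : N + z ≡ a
      N+z≡a = trans (multiplicity+zeros (decode A) i j g) (agr-distinct i j i≢j (to g))

      double-count : n * a + a + a ≡ suc (a * suc n) + suc n * z
      double-count = begin
        n * a + a + a               ≡⟨ cong (λ s → s + a + a) (∑-const n a) ⟨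
        ∑[ g < n ] a + a + a        ≡⟨ cong (λ s → s + a + a) (sum-cong-≗ (agr-distinct i j i≢j)) ⟨
        _                           ≡⟨ cong₂ (λ b c → ∑[ g < n ] agr (encode (decode A) i)
                                                                     (g •ʷ encode (decode A) j) + b + c)
                                         (zeros i) (zeros j) ⟨
        _                           ≡⟨ ∑-agr (encode (decode A) i) (encode (decode A) j) ⟩
        v + suc n * z               ≡⟨ cong (_+ suc n * z) v≡1+a*p ⟩
        suc (a * suc n) + suc n * z ∎

      collect : ∀ n a z N → a + a + (n * a + suc n * z) + suc n * N ≡ n * a + a + a + suc n * (N + z)
      collect = solve-∀

      regroup : ∀ n a z → suc (a * suc n) + suc n * z + suc n * a ≡ a + a + (n * a + suc n * z) + (a * n + 1)
      regroup = solve-∀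

    bgw : BGW G fin v k (μ * n)
    bgw = record
      { w        = decode A
      -- A row has a zeros, and v - a = 1 + a (n + 1) - a = a n + 1 = k.
      ; weight   = λ i → +-cancelʳ-≡ a _ _ (begin
          length (nonzeros G (decode A) i) + a
            ≡⟨ cong (length (nonzeros G (decode A) i) +_) (zeros i) ⟨
          length (nonzeros G (decode A) i) + agr 0ʷ (encode (decode A) i)
            ≡⟨ nonzeros+zeros (decode A) i ⟩
          v             ≡⟨ v≡1+a*p ⟩
          suc (a * suc n) ≡⟨ arith n a ⟩
          a * n + 1 + a ≡⟨ cong (_+ a) k≡ ⟩
          k + a         ∎)
      ; balanced = λ i j i≢j g → cong (_* n) (multiplicity≡ i j i≢j g)
      }
      where
      arith : ∀ n a → suc (a * suc n) ≡ a * n + 1 + a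
      arith = solve-∀

theorem7 : ∀ {c ℓ} (p : ℕ) → IsPrimePower p →
    (G : Group c ℓ) (fin : HasOrder G (p ∸ 1)) → IsCyclic G →
    BGW G fin (p + 1) p (p ∸ 1) →
    (m : ℕ) → .{{_ : NonZero m}} →
    BGW G fin (((p ^ (m + 1) ∸ 1) / (p ∸ 1)) {{order-nonZero G fin}}) (p ^ m) (p ^ (m ∸ 1) * (p ∸ 1))
-- Truncated subtraction makes the order 0 here, but a group contains its identity.
theorem7 zero    _ G fin = contradiction (Inverse.to fin (Group.ε G)) λ ()
theorem7 (suc n) _ G fin _ W (suc m) =
  subst (λ v → BGW G fin v (suc n ^ suc m) (suc n ^ m * n)) v≡ bgw
  where
  instance
    n≢0 : NonZero n
    n≢0 = order-nonZero G fin

  open Transport G fin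
  open FromBGW (subst (λ v → BGW G fin v (suc n) n) (+-comm (suc n) 1) W)
  open Step _ encode-equidistant no-common-zeros using (points; points-^; array; array-equidistant)
  -- The exponent of the theorem is `suc m`, so the weight is p^(m+1) = p p^m and each quotient
  -- occurs p^m times.
  open ToBGW {μ = suc n ^ m} (array (suc m)) (array-equidistant (suc m)) refl (points-^ (suc m)) refl using (bgw)

  v≡ : points (suc (suc m)) ≡ (suc n ^ (suc m + 1) ∸ 1) / n
  v≡ = begin
    points (suc (suc m))                    ≡⟨ m*n/n≡m (points (suc (suc m))) n ⟨
    points (suc (suc m)) * n / n            ≡⟨ cong (_/ n) (m+n∸n≡m (points (suc (suc m)) * n) 1) ⟨
    (points (suc (suc m)) * n + 1 ∸ 1) / n  ≡⟨ cong (λ q → (q ∸ 1) / n) (points-^ (suc (suc m))) ⟩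
    (suc n ^ suc (suc m) ∸ 1) / n           ≡⟨ cong (λ k → (suc n ^ k ∸ 1) / n) (+-comm (suc m) 1) ⟨
    (suc n ^ (suc m + 1) ∸ 1) / n           ∎
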